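{- Let $m,n$ be positive integers. Then $\mathrm{RR}(\mathcal{B}_m:\mathcal{B}_n)\leq m\,\mathrm{R}_{2^m-1}(\mathcal{B}_n)+m$.
   Context: $\mathcal{B}_N$ denotes the Boolean lattice of all subsets of $[N]$ ordered by inclusion. An induced copy of a poset $\mathcal{P}$ in a poset $\mathcal{Q}$ is the image of an injection $f:\mathcal{P}\to\mathcal{Q}$ with $f(X)\le f(Y)$ iff $X\le Y$. A colored family is monochromatic if all its sets share a color, rainbow if all its sets have pairwise distinct colors. $\mathrm{R}_k(\mathcal{P})$ is the smallest $n$ such that every coloring of $\mathcal{B}_n$ with $k$ colors contains a monochromatic induced copy of $\mathcal{P}$. The Boolean rainbow Ramsey number $\mathrm{RR}(\mathcal{Q}:\mathcal{P})$ is the smallest $n$ such that every coloring (with any number of colors) of the sets of $\mathcal{B}_n$ contains a rainbow induced copy of $\mathcal{Q}$ or a monochromatic induced copy of $\mathcal{P}$. -}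

module Defs where

open import Level using (Level; 0ℓ; _⊔_)
open import Data.Fin.Base using (Fin)
open import Data.Fin.Subset using (Subset)
open import Data.Fin.Subset.Properties using (⊆-poset)
open import Data.Nat.Base using (ℕ; _≤_)
open import Data.Product.Base using (∃; _×_)
open import Data.Sum.Base using (_⊎_)
open import Relation.Binary.Bundles using (Poset)
open import Relation.Binary.Morphism.Structures using (IsOrderMonomorphism)
open import Relation.Binary.PropositionalEquality.Core using (_≡_; _≢_)
open import Relation.Nullary.Negation.Core using (¬_)

private
  variable
    c ℓ₁ ℓ₂ c′ ℓ₁′ ℓ₂′ ℓ : Level

𝓑 : ℕ → Poset 0ℓ 0ℓ 0ℓ
𝓑 N = ⊆-poset N

-- An order monomorphism is an injection f with f X ≤ f Y iff X ≤ Y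
-- (fields mono and cancel).  The copy itself is the image of f.
record InducedCopy (P : Poset c ℓ₁ ℓ₂) (Q : Poset c′ ℓ₁′ ℓ₂′)
       : Set (c ⊔ ℓ₁ ⊔ ℓ₂ ⊔ c′ ⊔ ℓ₁′ ⊔ ℓ₂′) where
  private
    module P = Poset P
    module Q = Poset Q
  field
    embed               : P.Carrier → Q.Carrier
    isOrderMonomorphism : IsOrderMonomorphism P._≈_ Q._≈_ P._≤_ Q._≤_ embed

-- A colouring of 𝓑 N with k colours; not every colour has to be used.
Colouring : ℕ → ℕ → Set
Colouring k N = Subset N → Fin k

module _ {k N : ℕ} (χ : Colouring k N) {P : Poset c ℓ₁ ℓ₂} where
  open Poset P using (_≈_)
  open InducedCopy

  Monochromatic : InducedCopy P (𝓑 N) → Set c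
  Monochromatic f = ∃ λ i → ∀ X → χ (embed f X) ≡ i

  -- Since embed f is injective, distinct members of the copy are exactly
  -- the images of distinct elements of P.
  Rainbow : InducedCopy P (𝓑 N) → Set (c ⊔ ℓ₁)
  Rainbow f = ∀ X Y → ¬ (X ≈ Y) → χ (embed f X) ≢ χ (embed f Y)

IsLeast : (ℕ → Set ℓ) → ℕ → Set ℓ
IsLeast A n = A n × (∀ j → A j → n ≤ j)

RamseyProperty : ℕ → Poset c ℓ₁ ℓ₂ → ℕ → Set (c ⊔ ℓ₁ ⊔ ℓ₂)
RamseyProperty k P N =
  (χ : Colouring k N) → ∃ λ (f : InducedCopy P (𝓑 N)) → Monochromatic χ f

-- 𝓑 N is finite, so a colouring with arbitrarily many colours is a
-- colouring with k colours for some k.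
RainbowRamseyProperty :
  Poset c ℓ₁ ℓ₂ → Poset c′ ℓ₁′ ℓ₂′ → ℕ → Set (c ⊔ ℓ₁ ⊔ ℓ₂ ⊔ c′ ⊔ ℓ₁′ ⊔ ℓ₂′)
RainbowRamseyProperty Q P N =
  ∀ k (χ : Colouring k N) →
    (∃ λ (f : InducedCopy Q (𝓑 N)) → Rainbow χ f)
  ⊎ (∃ λ (f : InducedCopy P (𝓑 N)) → Monochromatic χ f)

-- The Ramsey numbers are given by their graphs: IsR k P r says R_k(P) = r,
-- and IsRR Q P s says RR(Q : P) = s.
IsR : ℕ → Poset c ℓ₁ ℓ₂ → ℕ → Set (c ⊔ ℓ₁ ⊔ ℓ₂)
IsR k P = IsLeast (RamseyProperty k P)

IsRR : Poset c ℓ₁ ℓ₂ → Poset c′ ℓ₁′ ℓ₂′ → ℕ → Set (c ⊔ ℓ₁ ⊔ ℓ₂ ⊔ c′ ⊔ ℓ₁′ ⊔ ℓ₂′)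
IsRR Q P = IsLeast (RainbowRamseyProperty Q P)

{-# OPTIONS --safe #-}
-- Cut a ground set of size b r + m into b blocks of size r and a remainder [m].
-- For any choice of subsets Y S of an r-set, the map sending S ⊆ [m] to S
-- together with the first ∣S∣ blocks and the copy of Y S in the next block embeds
-- 𝓑 m: if S ⊊ T, then T contains the whole block in which S uses Y S.  With S
-- fixed and Y S varying, these images form a copy of 𝓑 r.
--
-- With b = m only the image of the full set S = [m] is forced.  Choose the
-- remaining images one at a time so that colours never repeat.  If this fails at
-- some S, then a copy of 𝓑 r uses fewer than 2 ^ m colours, so it contains a
-- monochromatic copy of 𝓑 n.  With b = n + 1 the same embedding shows, by
-- induction on k, that R_k(𝓑 n) exists: either every S admits an image of colour 0,
-- or some copy of 𝓑 r avoids that colour.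
--
-- Least witnesses are found by exhaustive search.  For the rainbow property the
-- number of colours is first reduced to the number of subsets.
module Submission where

open import Defs
open import Data.Fin.Base using (Fin; zero; suc; inject≤; punchOut)
open import Data.Fin.Properties using (inject≤-injective; punchOut-injective; any?) renaming (_≟_ to _≟ᶠ_)
open import Data.Fin.Subset using (Subset; inside; outside; _⊆_; ∣_∣; ⊤; ⊥)
open import Data.Fin.Subset.Properties
open import Data.List.Base using (List; []; _∷_; [_]; _++_; map; length)
open import Data.List.Membership.Propositional using (_∈_; _∉_)
open import Data.List.Membership.Propositional.Properties using (∈-map⁺; ∈-++⁺ˡ; ∈-++⁺ʳ; ∈-++⁻)
open import Data.List.Membership.DecPropositional using () renaming (_∈?_ to ∈?)
open import Data.List.Membership.Setoid.Properties using (index-injective)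
open import Data.List.Properties using (length-map; length-++)
open import Data.List.Relation.Unary.All as All using (All; []; _∷_)
import Data.List.Relation.Unary.All.Properties as All
open import Data.List.Relation.Unary.Any using (here; there; index)
open import Data.Nat.Base using (ℕ; zero; suc; _+_; _*_; _∸_; _^_; _≤_; _<_; s≤s)
open import Data.Nat.Induction using (<-rec)
open import Data.Nat.Properties using (≤-reflexive; ≤-trans; m≤n⇒m≤1+n; m≤n+m∸n; ≮⇒≥; anyUpTo?; +-assoc; +-identityʳ)
open import Data.Product.Base using (∃; _×_; _,_; proj₁; proj₂)
open import Data.Sum.Base as Sum using (_⊎_; inj₁; inj₂; [_,_]′)
open import Data.Vec.Base as Vec using ([]; _∷_)
import Data.Vec.Properties as Vec
import Data.Bool.Properties as Bool
open import Function.Base using (_∘_; const)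
import Relation.Binary.Morphism.Construct.Composition as Composition
open import Relation.Binary.Definitions using (DecidableEquality)
open import Relation.Binary.Morphism.Structures using (module IsOrderMonomorphism)
open import Relation.Binary.PropositionalEquality
  using (_≡_; _≢_; _≗_; refl; sym; trans; cong; cong₂; subst; subst₂; setoid; module ≡-Reasoning)
open import Relation.Nullary using (Dec; yes; no; ¬_; contradiction)
open import Relation.Nullary.Decidable using (map′; _×-dec_; _⊎-dec_; _→-dec_; ¬?; decidable-stable)
open import Relation.Unary using (Decidable)

open InducedCopy

private
  variable
    A B C : Set
    k l m n r N : ℕ

infix 4 _≟ˢ_

_≟ˢ_ : DecidableEquality (Subset N)
_≟ˢ_ = Vec.≡-dec Bool._≟_

-- Exhaustive search

all⊎counterexample : {P : Subset N → Set} → Decidable P → (∀ X → P X) ⊎ ∃ λ X → ¬ P X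
all⊎counterexample P? with anySubset? (¬? ∘ P?)
... | yes ∃¬ = inj₂ ∃¬
... | no ¬∃¬ = inj₁ λ X → decidable-stable (P? X) (λ ¬p → ¬∃¬ (X , ¬p))

allSubsets? : {P : Subset N → Set} → Decidable P → Dec (∀ X → P X)
allSubsets? P? with all⊎counterexample P?
... | inj₁ ∀P       = yes ∀P
... | inj₂ (X , ¬p) = no λ ∀P → ¬p (∀P X)

Exhaustible : Set → Set₁
Exhaustible A = {P : A → Set} → Decidable P → Dec (∃ P)

glue : (Subset N → A) → (Subset N → A) → Subset (suc N) → A
glue f g (outside ∷ p) = f p
glue f g (inside  ∷ p) = g p

glue-cong : {f f′ g g′ : Subset N → A} → f ≗ f′ → g ≗ g′ → glue f g ≗ glue f′ g′
glue-cong f≗f′ g≗g′ (outside ∷ p) = f≗f′ p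
glue-cong f≗f′ g≗g′ (inside  ∷ p) = g≗g′ p

glue-restrictions : (f : Subset (suc N) → A) → f ≗ glue (f ∘ (outside ∷_)) (f ∘ (inside ∷_))
glue-restrictions f (outside ∷ p) = refl
glue-restrictions f (inside  ∷ p) = refl

-- Induction on `N`: a function on `Subset (suc N)` is glued from two functions on `Subset N`. It
-- agrees with the glued one only pointwise, so `P` has to respect `_≗_`.
anyFunction? : Exhaustible A → {P : (Subset N → A) → Set} →
               (∀ {f g} → f ≗ g → P f → P g) → Decidable P → Dec (∃ P)
anyFunction? {N = zero} search resp P? =
  map′ (λ (a , p) → const a , p)
       (λ (f , p) → f [] , resp (λ { [] → refl }) p)
       (search (P? ∘ const))
anyFunction? {N = suc N} search resp P? =
  map′ (λ (f , g , p) → glue f g , p)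
       (λ (f , p) → _ , _ , resp (glue-restrictions f) p)
       (anyFunction? search
         (λ f≗f′ (g , p) → g , resp (glue-cong f≗f′ (λ _ → refl)) p)
         (λ f → anyFunction? search (resp ∘ glue-cong (λ _ → refl)) (P? ∘ glue f)))

allColourings? : {P : Colouring k N → Set} →
                 (∀ {χ ψ} → χ ≗ ψ → P χ → P ψ) → Decidable P → Dec (∀ χ → P χ)
allColourings? resp P? =
  map′ (λ ¬∃ χ → decidable-stable (P? χ) (λ ¬p → ¬∃ (χ , ¬p)))
       (λ ∀P (χ , ¬p) → ¬p (∀P χ))
       (¬? (anyFunction? any? (λ χ≗ψ ¬p p → ¬p (resp (sym ∘ χ≗ψ) p)) (¬? ∘ P?)))

least : {P : ℕ → Set} → Decidable P → ∀ n → P n → ∃ (IsLeast P)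
least {P} P? = <-rec _ step
  where
  step : ∀ n → (∀ {i} → i < n → P i → ∃ (IsLeast P)) → P n → ∃ (IsLeast P)
  step n rec Pn with anyUpTo? P? n
  ... | yes (i , i<n , Pi) = rec i<n Pi
  ... | no  ¬∃             = n , Pn , λ j Pj → ≮⇒≥ λ j<n → ¬∃ (j , j<n , Pj)

-- Induced copies of Boolean lattices

-- The decidable core of an induced copy; injectivity follows from it by antisymmetry.
IsEmbedding : (Subset m → Subset N) → Set
IsEmbedding f = ∀ X Y → (X ⊆ Y → f X ⊆ f Y) × (f X ⊆ f Y → X ⊆ Y)

fromEmbedding : (f : Subset m → Subset N) → IsEmbedding f → InducedCopy (𝓑 m) (𝓑 N)
fromEmbedding f emb = record
  { embed = f
  ; isOrderMonomorphism = record
    { isOrderHomomorphism = record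
      { cong = cong f
      ; mono = λ {X} {Y} → proj₁ (emb X Y)
      }
    ; injective = λ {X} {Y} fX≡fY →
        ⊆-antisym (proj₂ (emb X Y) (⊆-reflexive fX≡fY))
                  (proj₂ (emb Y X) (⊆-reflexive (sym fX≡fY)))
    ; cancel = λ {X} {Y} → proj₂ (emb X Y)
    }
  }

toEmbedding : (f : InducedCopy (𝓑 m) (𝓑 N)) → IsEmbedding (embed f)
toEmbedding f X Y = mono , cancel
  where open IsOrderMonomorphism (isOrderMonomorphism f)

compose : InducedCopy (𝓑 r) (𝓑 N) → InducedCopy (𝓑 n) (𝓑 r) → InducedCopy (𝓑 n) (𝓑 N)
compose g f = record
  { embed = embed g ∘ embed f
  ; isOrderMonomorphism =
      Composition.isOrderMonomorphism (isOrderMonomorphism f) (isOrderMonomorphism g)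
  }

anyCopy? : {P : (Subset m → Subset N) → Set} →
           (∀ {f g} → f ≗ g → P f → P g) → Decidable P →
           Dec (∃ λ (f : InducedCopy (𝓑 m) (𝓑 N)) → P (embed f))
anyCopy? {P = P} resp P? =
  map′ (λ (f , emb , p) → fromEmbedding f emb , p)
       (λ (f , p) → embed f , toEmbedding f , p)
       (anyFunction? anySubset? resp′
         (λ f → allSubsets? (λ X → allSubsets? (λ Y →
                  ((X ⊆? Y) →-dec (f X ⊆? f Y)) ×-dec ((f X ⊆? f Y) →-dec (X ⊆? Y))))
                ×-dec P? f))
  where
  resp′ : ∀ {f g} → f ≗ g → IsEmbedding f × P f → IsEmbedding g × P g
  resp′ f≗g (emb , p) =
    (λ X Y → subst₂ (λ U V → (X ⊆ Y → U ⊆ V) × (U ⊆ V → X ⊆ Y)) (f≗g X) (f≗g Y) (emb X Y))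
    , resp f≗g p

-- Monochromatic and rainbow copies, and their dependence on the colouring

MonochromaticCopy : Colouring k N → ℕ → Set
MonochromaticCopy {N = N} χ n = ∃ λ (f : InducedCopy (𝓑 n) (𝓑 N)) → Monochromatic χ f

RainbowCopy : Colouring k N → ℕ → Set
RainbowCopy {N = N} χ m = ∃ λ (f : InducedCopy (𝓑 m) (𝓑 N)) → Rainbow χ f

module _ (χ : Colouring k N) where

  monochromaticCopy? : ∀ n → Dec (MonochromaticCopy χ n)
  monochromaticCopy? n =
    anyCopy? (λ f≗g (i , eq) → i , λ X → trans (cong χ (sym (f≗g X))) (eq X))
             (λ f → any? λ i → allSubsets? λ X → χ (f X) ≟ᶠ i)

  rainbowCopy? : ∀ m → Dec (RainbowCopy χ m)
  rainbowCopy? m =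
    anyCopy? {P = λ f → ∀ X Y → X ≢ Y → χ (f X) ≢ χ (f Y)}
      (λ f≗g neq X Y X≢Y →
        subst₂ (λ U V → χ U ≢ χ V) (f≗g X) (f≗g Y) (neq X Y X≢Y))
      (λ f → allSubsets? λ X → allSubsets? λ Y →
        ¬? (X ≟ˢ Y) →-dec ¬? (χ (f X) ≟ᶠ χ (f Y)))

-- Compares the partitions into colour classes, so the two palettes may differ.
_Refines_ : Colouring k N → Colouring l N → Set
χ Refines ψ = ∀ X Y → χ X ≡ χ Y → ψ X ≡ ψ Y

module _ {χ : Colouring k N} {ψ : Colouring l N} where

  monochromatic-coarsen : χ Refines ψ → MonochromaticCopy χ n → MonochromaticCopy ψ n
  monochromatic-coarsen χ⊑ψ (f , i , eq) =
    f , ψ (embed f ⊥) , λ X → χ⊑ψ _ _ (trans (eq X) (sym (eq ⊥)))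

  rainbow-refine : ψ Refines χ → RainbowCopy χ m → RainbowCopy ψ m
  rainbow-refine ψ⊑χ (f , neq) = f , λ X Y X≢Y eq → neq X Y X≢Y (ψ⊑χ _ _ eq)

≗⇒Refines : {χ ψ : Colouring k N} → χ ≗ ψ → χ Refines ψ
≗⇒Refines χ≗ψ X Y eq = trans (sym (χ≗ψ X)) (trans eq (χ≗ψ Y))

ramseyProperty? : ∀ k n → Decidable (RamseyProperty k (𝓑 n))
ramseyProperty? k n N =
  allColourings? (λ χ≗ψ → monochromatic-coarsen (≗⇒Refines χ≗ψ))
                 (λ χ → monochromaticCopy? χ n)

-- Enumeration of subsets

-- `⊤` is kept apart, at the end of `subsets m`: with `m` blocks it is the one set that leaves no
-- block free, and the greedy choice starts from it.
properSubsets : ∀ m → List (Subset m)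
subsets       : ∀ m → List (Subset m)

properSubsets zero    = []
properSubsets (suc m) = map (outside ∷_) (subsets m) ++ map (inside ∷_) (properSubsets m)

subsets m = properSubsets m ++ [ ⊤ ]

∈-subsets : (p : Subset m) → p ∈ subsets m
∈-subsets []            = here refl
∈-subsets (outside ∷ p) = ∈-++⁺ˡ (∈-++⁺ˡ (∈-map⁺ _ (∈-subsets p)))
∈-subsets {suc m} (inside ∷ p) with ∈-++⁻ (properSubsets m) (∈-subsets p)
... | inj₁ p∈          = ∈-++⁺ˡ (∈-++⁺ʳ (map _ (subsets m)) (∈-map⁺ _ p∈))
... | inj₂ (here refl) = ∈-++⁺ʳ (properSubsets (suc m)) (here refl)

properSubsets-< : ∀ m → All (λ p → ∣ p ∣ < m) (properSubsets m)
properSubsets-< zero    = []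
properSubsets-< (suc m) =
  All.++⁺ (All.map⁺ (All.universal (s≤s ∘ ∣p∣≤n) (subsets m)))
          (All.map⁺ (All.map s≤s (properSubsets-< m)))

length-subsets : ∀ m → length (subsets m) ≡ 2 ^ m
length-subsets zero    = refl
length-subsets (suc m) = begin
  length (properSubsets (suc m) ++ [ ⊤ ])
    ≡⟨ length-++ (properSubsets (suc m)) ⟩
  length (properSubsets (suc m)) + 1
    ≡⟨ cong (_+ 1) (length-++ (map (outside ∷_) (subsets m))) ⟩
  length (map (outside ∷_) (subsets m)) + length (map (inside ∷_) (properSubsets m)) + 1
    ≡⟨ cong₂ (λ a b → a + b + 1) (length-map _ (subsets m)) (length-map _ (properSubsets m)) ⟩
  length (subsets m) + length (properSubsets m) + 1
    ≡⟨ +-assoc (length (subsets m)) _ 1 ⟩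
  length (subsets m) + (length (properSubsets m) + 1)
    ≡⟨ cong (length (subsets m) +_) (length-++ (properSubsets m)) ⟨
  length (subsets m) + length (subsets m)
    ≡⟨ cong₂ _+_ (length-subsets m) (trans (length-subsets m) (sym (+-identityʳ _))) ⟩
  2 ^ suc m ∎
  where open ≡-Reasoning

-- Reduction to a bounded number of colours

-- Each colour class is named by the list position of one of its members.
recolour : (χ : Colouring k N) →
           ∃ λ (ψ : Colouring (length (subsets N)) N) → χ Refines ψ × ψ Refines χ
recolour {k} {N} χ = ι ∘ representative ∘ χ , (λ X Y → cong (ι ∘ representative)) , ψ-refines
  where
  ι : Subset N → Fin (length (subsets N))
  ι = index ∘ ∈-subsets

  representative : Fin k → Subset N
  representative c with anySubset? (λ X → χ X ≟ᶠ c)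
  ... | yes (X , _) = X
  -- A default for colours that do not occur; `ψ` never meets it.
  ... | no  _       = ⊥

  χ-representative : ∀ X → χ (representative (χ X)) ≡ χ X
  χ-representative X with anySubset? (λ Y → χ Y ≟ᶠ χ X)
  ... | yes (Y , eq) = eq
  ... | no  ¬∃       = contradiction (X , refl) ¬∃

  ψ-refines : (ι ∘ representative ∘ χ) Refines χ
  ψ-refines X Y eq =
    trans (sym (χ-representative X))
          (trans (cong χ (index-injective (setoid _) (∈-subsets _) (∈-subsets _) eq))
                 (χ-representative Y))

-- By `recolour`, the unbounded quantifier over `k` reduces to the single case
-- `k = length (subsets N)`, which is a finite search.
rainbowRamseyProperty? : ∀ m n → Decidable (RainbowRamseyProperty (𝓑 m) (𝓑 n))
rainbowRamseyProperty? m n N =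
  map′ (λ prop k χ → let ψ , χ⊑ψ , ψ⊑χ = recolour χ in
          Sum.map (rainbow-refine χ⊑ψ) (monochromatic-coarsen ψ⊑χ) (prop ψ))
       (λ prop → prop (length (subsets N)))
       (allColourings?
         (λ χ≗ψ → Sum.map (rainbow-refine (≗⇒Refines (sym ∘ χ≗ψ)))
                          (monochromatic-coarsen (≗⇒Refines χ≗ψ)))
         (λ χ → rainbowCopy? χ m ⊎-dec monochromaticCopy? χ n))

-- The block embedding

-- For `j` at least `b` every block is full and `Y` leaves no trace; hence the bound `j < b` in
-- `fill-cancel`.
fill : ℕ → (b : ℕ) → Subset r → Subset (b * r)
fill j       zero    Y = []
fill zero    (suc b) Y = Y Vec.++ ⊥
fill (suc j) (suc b) Y = ⊤ Vec.++ fill j b Y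

⊆-++⁺ : {p p′ : Subset m} {q q′ : Subset n} → p ⊆ p′ → q ⊆ q′ → p Vec.++ q ⊆ p′ Vec.++ q′
⊆-++⁺ {p = []}          {[]}          p⊆p′ q⊆q′ = q⊆q′
⊆-++⁺ {p = outside ∷ p} {y ∷ p′}      p⊆p′ q⊆q′ = out⊆ (⊆-++⁺ (drop-∷-⊆ p⊆p′) q⊆q′)
⊆-++⁺ {p = inside ∷ p}  {outside ∷ _} p⊆p′ q⊆q′ = contradiction (p⊆p′ Vec.here) λ ()
⊆-++⁺ {p = inside ∷ p}  {inside ∷ p′} p⊆p′ q⊆q′ = in⊆in (⊆-++⁺ (drop-∷-⊆ p⊆p′) q⊆q′)

⊆-++⁻ʳ : (p p′ : Subset m) {q q′ : Subset n} → p Vec.++ q ⊆ p′ Vec.++ q′ → q ⊆ q′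
⊆-++⁻ʳ []      []       sub = sub
⊆-++⁻ʳ (x ∷ p) (y ∷ p′) sub = ⊆-++⁻ʳ p p′ (drop-∷-⊆ sub)

⊆-++⁻ˡ : (p p′ : Subset m) {q q′ : Subset n} → p Vec.++ q ⊆ p′ Vec.++ q′ → p ⊆ p′
⊆-++⁻ˡ []            []             sub = λ ()
⊆-++⁻ˡ (outside ∷ p) (y ∷ p′)       sub = out⊆ (⊆-++⁻ˡ p p′ (drop-∷-⊆ sub))
⊆-++⁻ˡ (inside ∷ p)  (outside ∷ p′) sub = contradiction (sub Vec.here) λ ()
⊆-++⁻ˡ (inside ∷ p)  (inside ∷ p′)  sub = in⊆in (⊆-++⁻ˡ p p′ (drop-∷-⊆ sub))

-- Blocks before `i` are full on both sides, block `i` is full on the right, and later blocks are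
-- empty on the left. So `Y` and `Z` can be chosen independently.
fill-< : ∀ {i j} b {Y Z : Subset r} → i < j → fill i b Y ⊆ fill j b Z
fill-<             zero        i<j       = ⊆-refl
fill-< {i = zero}  (suc b) {Y} (s≤s _)   = ⊆-++⁺ {p = Y} ⊆⊤ ⊥⊆
fill-< {i = suc i} (suc b)     (s≤s i<j) = ⊆-++⁺ ⊆-refl (fill-< b i<j)

fill-mono : ∀ j b {Y Z : Subset r} → Y ⊆ Z → fill j b Y ⊆ fill j b Z
fill-mono j       zero    Y⊆Z = ⊆-refl
fill-mono zero    (suc b) Y⊆Z = ⊆-++⁺ Y⊆Z ⊆-refl
fill-mono (suc j) (suc b) Y⊆Z = ⊆-++⁺ ⊆-refl (fill-mono j b Y⊆Z)

fill-cancel : ∀ {j b} → j < b → {Y Z : Subset r} → fill j b Y ⊆ fill j b Z → Y ⊆ Z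
fill-cancel {j = zero}  (s≤s _)   {Y} {Z} sub = ⊆-++⁻ˡ Y Z sub
fill-cancel {j = suc j} (s≤s j<b)         sub = fill-cancel j<b (⊆-++⁻ʳ ⊤ ⊤ sub)

⊆⇒≡∨∣<∣ : {p q : Subset m} → p ⊆ q → p ≡ q ⊎ ∣ p ∣ < ∣ q ∣
⊆⇒≡∨∣<∣ {p = []}          {[]}          p⊆q = inj₁ refl
⊆⇒≡∨∣<∣ {p = outside ∷ p} {outside ∷ q} p⊆q = Sum.map₁ (cong _) (⊆⇒≡∨∣<∣ (drop-∷-⊆ p⊆q))
⊆⇒≡∨∣<∣ {p = outside ∷ p} {inside ∷ q}  p⊆q = inj₂ (s≤s (p⊆q⇒∣p∣≤∣q∣ (drop-∷-⊆ p⊆q)))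
⊆⇒≡∨∣<∣ {p = inside ∷ p}  {outside ∷ q} p⊆q = contradiction (p⊆q Vec.here) λ ()
⊆⇒≡∨∣<∣ {p = inside ∷ p}  {inside ∷ q}  p⊆q = Sum.map (cong _) s≤s (⊆⇒≡∨∣<∣ (drop-∷-⊆ p⊆q))

block : ∀ b → Subset m → Subset r → Subset (b * r + m)
block b S Y = fill ∣ S ∣ b Y Vec.++ S

transversal : ∀ b → (Subset m → Subset r) → InducedCopy (𝓑 m) (𝓑 (b * r + m))
transversal b Y = fromEmbedding (λ S → block b S (Y S))
  -- Inclusion is reflected by the last `m` coordinates, where `block` stores `S` itself.
  λ S T → mono S T , ⊆-++⁻ʳ (fill ∣ S ∣ b (Y S)) (fill ∣ T ∣ b (Y T))
  where
  mono : ∀ S T → S ⊆ T → block b S (Y S) ⊆ block b T (Y T)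
  mono S T S⊆T with ⊆⇒≡∨∣<∣ S⊆T
  ... | inj₁ refl = ⊆-refl
  ... | inj₂ lt   = ⊆-++⁺ (fill-< b lt) S⊆T

section : ∀ b (S : Subset m) → ∣ S ∣ < b → InducedCopy (𝓑 r) (𝓑 (b * r + m))
section b S lt = fromEmbedding (block b S)
  λ Y Z → (λ Y⊆Z → ⊆-++⁺ (fill-mono ∣ S ∣ b Y⊆Z) ⊆-refl)
        , (λ sub → fill-cancel lt (⊆-++⁻ˡ (fill ∣ S ∣ b Y) (fill ∣ S ∣ b Z) sub))

-- Ramsey numbers

monochromatic-compose : (χ : Colouring l N) (g : InducedCopy (𝓑 r) (𝓑 N)) →
  MonochromaticCopy (χ ∘ embed g) n → MonochromaticCopy χ n
monochromatic-compose χ g (f , mono) = compose g f , mono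

ramsey-exists : ∀ k n → ∃ (RamseyProperty k (𝓑 n))
ramsey-exists zero    n = zero , λ χ → contradiction (χ ⊥) λ ()
ramsey-exists (suc k) n with ramsey-exists k n
... | r , ramsey = b * r + n , prop
  where
  -- One block more than `n`, so that even `S = ⊤` has a free block and `section` applies to every
  -- `S`.
  b = suc n

  prop : RamseyProperty (suc k) (𝓑 n) (b * r + n)
  prop χ with all⊎counterexample (λ S → anySubset? {n = r} (λ Y → χ (block b S Y) ≟ᶠ zero))
  ... | inj₁ hit          = transversal b (proj₁ ∘ hit) , zero , proj₂ ∘ hit
  ... | inj₂ (S , avoids) =
    -- The section at `S` misses colour `zero`; punching it out leaves `k` colours for the induction
    -- hypothesis.
    monochromatic-compose χ (section b S (s≤s (∣p∣≤n S)))
      (monochromatic-coarsen (λ Y Z → punchOut-injective (nonzero Y) (nonzero Z))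
        (ramsey (λ Y → punchOut (nonzero Y))))
    where
    nonzero : ∀ Y → zero ≢ χ (block b S Y)
    nonzero Y eq = avoids (Y , sym eq)

-- Colour `Y` by the position of `χ Y` in `cs`: equal positions mean equal colours.
few-colours : RamseyProperty k (𝓑 n) r → (χ : Colouring l r) (cs : List (Fin l)) →
              length cs ≤ k → (∀ Y → χ Y ∈ cs) → MonochromaticCopy χ n
few-colours ramsey χ cs len χ∈cs =
  monochromatic-coarsen
    (λ Y Z eq → index-injective (setoid _) (χ∈cs Y) (χ∈cs Z) (inject≤-injective len len _ _ eq))
    (ramsey (λ Y → inject≤ (index (χ∈cs Y)) len))

-- Greedy choice of distinct colours

module Greedy (_≟_ : DecidableEquality A) (colour : A → B → C) where

  DistinctOn : List A → Set
  DistinctOn xs = ∃ λ (Y : A → B) →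
    ∀ {a b} → a ∈ xs → b ∈ xs → a ≢ b → colour a (Y a) ≢ colour b (Y b)

  -- `F` is the way out when `cs` blocks every choice at `a`; it will be the existence of a
  -- monochromatic copy.
  Extendable : Set → ℕ → A → Set
  Extendable F K a = ∀ cs → length cs ≤ K → F ⊎ ∃ λ y → colour a y ∉ cs

  -- Only the value at `x` changes, so a new clash would involve `x`, which freshness excludes.
  extend : ∀ x xs ((Y , _) : DistinctOn xs) →
           (∃ λ y → colour x y ∉ map (λ a → colour a (Y a)) xs) → DistinctOn (x ∷ xs)
  extend x xs (Y , distinct) (y , fresh) = Y′ , distinct′
    where
    Y′ : A → B
    Y′ a with a ≟ x
    ... | yes _ = y
    ... | no  _ = Y a

    ∈-tail : ∀ {a} → a ∈ x ∷ xs → a ≢ x → a ∈ xs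
    ∈-tail (here a≡x)   a≢x = contradiction a≡x a≢x
    ∈-tail (there a∈xs) _   = a∈xs

    distinct′ : ∀ {a b} → a ∈ x ∷ xs → b ∈ x ∷ xs → a ≢ b → colour a (Y′ a) ≢ colour b (Y′ b)
    distinct′ {a} {b} a∈ b∈ a≢b with a ≟ x | b ≟ x
    ... | yes refl | yes refl = contradiction refl a≢b
    ... | yes refl | no b≢x   = λ eq → fresh (subst (_∈ map (λ a → colour a (Y a)) xs) (sym eq) (∈-map⁺ _ (∈-tail b∈ b≢x)))
    ... | no a≢x   | yes refl = λ eq → fresh (subst (_∈ map (λ a → colour a (Y a)) xs) eq (∈-map⁺ _ (∈-tail a∈ a≢x)))
    ... | no a≢x   | no b≢x   = distinct (∈-tail a∈ a≢x) (∈-tail b∈ b≢x) a≢b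

  greedy : ∀ {F K} xs {ys} → All (Extendable F K) xs → length (xs ++ ys) ≤ suc K →
           DistinctOn ys → F ⊎ DistinctOn (xs ++ ys)
  greedy []       []         len       dist = inj₂ dist
  greedy (x ∷ xs) (px ∷ pxs) (s≤s len) dist with greedy xs pxs (m≤n⇒m≤1+n len) dist
  ... | inj₁ F     = inj₁ F
  ... | inj₂ dist′ =
    -- The colours forbidden at `x` are those on `xs ++ ys`, one fewer than the whole list, hence at
    -- most `K`.
    Sum.map₂ (extend x _ dist′) (px _ (≤-trans (≤-reflexive (length-map _ (xs ++ _))) len))

rainbow-bound : ∀ m n r → RamseyProperty (2 ^ m ∸ 1) (𝓑 n) r →
                RainbowRamseyProperty (𝓑 m) (𝓑 n) (m * r + m)
rainbow-bound m n r ramsey k χ =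
  [ inj₂ , inj₁ ∘ rainbow ]′
    (greedy (properSubsets m) (All.map extendable (properSubsets-< m))
      (≤-trans (≤-reflexive (length-subsets m)) (m≤n+m∸n (2 ^ m) 1)) top)
  where
  colour : Subset m → Subset r → Fin k
  colour S Y = χ (block m S Y)

  open Greedy _≟ˢ_ colour

  top : DistinctOn [ ⊤ ]
  -- Any value would do: for `⊤` all `m` blocks are full, and a single set cannot clash with
  -- another.
  top = const ⊥ , λ { (here refl) (here refl) ⊤≢⊤ → contradiction refl ⊤≢⊤ }

  extendable : ∀ {S} → ∣ S ∣ < m → Extendable (MonochromaticCopy χ n) (2 ^ m ∸ 1) S
  extendable {S} lt cs len with all⊎counterexample (λ Y → ∈? _≟ᶠ_ (colour S Y) cs)
  -- If no image of `S` has a fresh colour, its section uses at most `2 ^ m ∸ 1` colours.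
  ... | inj₁ S∈cs  = inj₁ (monochromatic-compose χ (section m S lt)
                             (few-colours ramsey (colour S) cs len S∈cs))
  ... | inj₂ fresh = inj₂ fresh

  rainbow : DistinctOn (subsets m) → RainbowCopy χ m
  rainbow (Y , distinct) = transversal m Y , λ S T → distinct (∈-subsets S) (∈-subsets T)

theorem1p5 : (m n : ℕ) → 1 ≤ m → 1 ≤ n →
    ∃ λ r → IsR (2 ^ m ∸ 1) (𝓑 n) r ×
    (∃ λ s → IsRR (𝓑 m) (𝓑 n) s × s ≤ m * r + m)
theorem1p5 m n _ _ =
  let _ , ramsey₀     = ramsey-exists (2 ^ m ∸ 1) n
      r , isR         = least (ramseyProperty? (2 ^ m ∸ 1) n) _ ramsey₀
      -- `bound` serves twice: it starts the search for `s`, and minimality of `s` against it gives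
      -- the inequality.
      bound           = rainbow-bound m n r (proj₁ isR)
      s , isRR        = least (rainbowRamseyProperty? m n) _ bound
  in r , isR , s , isRR , proj₂ isRR _ bound
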